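{- Suppose that $G$ is a twin-free digraph of order $n$. Let $S$ be a dominating set of $G$ such that the $S$-partition of $V(G)\setminus S$ contains at least $x\cdot|S|$ parts (with $0<x\leq 1$). Then $\gamma_L(G)\leq\frac{2x+1}{3x+1}n$. Moreover, if $G$ is also quasi-twin-free, then $\gamma_L(G)\leq\frac{x+1}{2x+1}n$.
   Context: Digraphs are loopless without multiple arcs. A dominating set of a digraph $G$ is a set $D$ such that every vertex not in $D$ has an in-neighbour in $D$; it is locating-dominating if moreover every vertex not in $D$ has a distinct set of in-neighbours in $D$. $\gamma_L(G)$ is the minimum size of a locating-dominating set. Two vertices are twins if they have the same open in-neighbourhood or the same closed in-neighbourhood; $x,y$ are quasi-twins if $N^-(x)=N^-(y)\cup\{y\}$. For $S\subseteq V(G)$, the $S$-partition of $V(G)\setminus S$ is the partition where two vertices are in the same part iff they have the same set of in-neighbours in $S$.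
   Formalization: The parameter x with 0<x≤1 is taken to be rational, x=p/q; the real case follows by applying it to min(1, parts/|S|), since both bounds decrease in x. -}

module Defs where

open import Data.Nat using (ℕ; _*_; _+_; _≤_)
open import Data.Bool using (Bool; true; false)
open import Data.Bool.Properties using () renaming (_≟_ to _≟ᵇ_)
open import Data.Fin using (Fin)
open import Data.Fin.Subset using (Subset; _∈_; _∉_; _∪_; _∩_; ⁅_⁆; ∣_∣)
open import Data.Fin.Subset.Properties using (_∈?_)
open import Data.Vec using (tabulate)
open import Data.Vec.Properties using (≡-dec)
open import Data.List using (List; length; map; filter; deduplicate)
open import Data.List using (allFin) public
open import Data.Product using (Σ; _×_; ∃)
open import Data.Sum using (_⊎_)
open import Relation.Nullary using (¬_; ¬?)
open import Relation.Binary.PropositionalEquality using (_≡_; _≢_)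

-- A digraph on vertex set Fin n: Arc u v = true iff there is an arc u → v.
-- (No multiple arcs by construction; looplessness is a field.)
record Digraph (n : ℕ) : Set where
  field
    Arc      : Fin n → Fin n → Bool
    loopless : ∀ v → Arc v v ≡ false

module _ {n : ℕ} (G : Digraph n) where
  open Digraph G

  N⁻ : Fin n → Subset n
  N⁻ v = tabulate (λ u → Arc u v)

  N⁻[_] : Fin n → Subset n
  N⁻[ v ] = N⁻ v ∪ ⁅ v ⁆

  Twins : Fin n → Fin n → Set
  Twins x y = x ≢ y × (N⁻ x ≡ N⁻ y ⊎ N⁻[ x ] ≡ N⁻[ y ])

  TwinFree : Set
  TwinFree = ∀ x y → ¬ Twins x y

  QuasiTwins : Fin n → Fin n → Set
  QuasiTwins x y = N⁻ x ≡ N⁻ y ∪ ⁅ y ⁆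

  QuasiTwinFree : Set
  QuasiTwinFree = ∀ x y → ¬ QuasiTwins x y

  Dominating : Subset n → Set
  Dominating D = ∀ v → v ∉ D → ∃ λ u → u ∈ D × Arc u v ≡ true

  LocatingDominating : Subset n → Set
  LocatingDominating D =
    Dominating D × (∀ u v → u ∉ D → v ∉ D → u ≢ v → N⁻ u ∩ D ≢ N⁻ v ∩ D)

  -- number of parts of the S-partition of V(G) ∖ S:
  -- number of distinct traces N⁻(v) ∩ S over vertices v ∉ S
  partitionSize : Subset n → ℕ
  partitionSize S =
    length (deduplicate (≡-dec _≟ᵇ_)
      (map (λ v → N⁻ v ∩ S) (filter (λ v → ¬? (v ∈? S)) (allFin n))))

-- γL≤[ b / a ] G  :⇔  a·γ_L(G) ≤ b·n, i.e. some locating-dominating set D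
-- satisfies a·|D| ≤ b·n  (equivalently γ_L(G) ≤ (b/a)·n)
γL≤[_/_] : ℕ → ℕ → ∀ {n} → Digraph n → Set
γL≤[ b / a ] {n} G = Σ (Subset n) λ D → LocatingDominating G D × a * ∣ D ∣ ≤ b * n

{-# OPTIONS --safe #-}

-- Call (S , R) a configuration when S is dominating and R consists of vertices
-- outside S with pairwise distinct traces on S.  The complement of R is then
-- locating-dominating.  If two vertices u, v outside T = S ∪ R have the same
-- T-trace but are separated by some w other than u and v, then w can be added to S
-- and u or v to R; since x ≤ 1 this keeps |R| ≥ x |S|.  Once no such w exists,
-- twin-freeness forces two vertices with the same T-trace to be quasi-twins joined
-- by exactly one arc, and no vertex is both a source and a target of such arcs.
-- So adding to T all the sources, or all the targets, whichever are fewer, gives a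
-- locating-dominating set of size at most (n + |S| + |R|) / 2.  Without quasi-twins
-- T itself is locating-dominating.  The bounds follow by comparing with n − |R|.
module Submission where

open import Defs
open import Data.Bool using (true; false; _∧_; _∨_)
open import Data.Bool.Properties
  using (∧-identityʳ; ∧-zeroʳ; ∨-identityʳ; ∨-zeroʳ; ¬-not) renaming (_≟_ to _≟ᵇ_)
open import Data.Empty using (⊥-elim)
open import Data.Fin using (Fin; _≟_)
open import Data.Fin.Properties using (any?; all?)
open import Data.Fin.Subset using (Subset; ∣_∣; _∈_; _∉_; _⊆_; _∪_; _∩_; ∁; ⁅_⁆) renaming (⊥ to ∅)
open import Data.Fin.Subset.Properties
open import Data.List using (List; []; _∷_; length; map; filter; deduplicate)
open import Data.List.Membership.Propositional using () renaming (_∈_ to _∈ˡ_)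
open import Data.List.Membership.Propositional.Properties using (∈-map⁻; ∈-filter⁻; ∈-deduplicate⁻)
open import Data.List.Relation.Unary.All using (All; []; _∷_; tabulate)
import Data.List.Relation.Unary.All as All
open import Data.List.Relation.Unary.Any using (here; there)
open import Data.List.Relation.Unary.AllPairs using ([]; _∷_)
open import Data.List.Relation.Unary.Unique.Propositional using (Unique)
open import Data.List.Relation.Unary.Unique.DecPropositional.Properties using (deduplicate-!)
open import Data.Nat using (ℕ; zero; suc; _*_; _+_; _≤_; _<_; NonZero; >-nonZero)
open import Data.Nat.Properties hiding (_≟_)
open import Data.Nat.Tactic.RingSolver using (solve-∀)
open import Data.Product using (Σ; _×_; _,_; ∃; proj₁; proj₂)
open import Data.Sum using (_⊎_; inj₁; inj₂; [_,_]′)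
open import Data.Vec using ([]; _∷_; lookup; here; there) renaming (tabulate to tabulateᵛ)
open import Data.Vec.Properties
  using (≡-dec; lookup∘tabulate; tabulate∘lookup; tabulate-cong; lookup-zipWith; []=⇒lookup; lookup⇒[]=)
open import Function using (_∘_; case_of_)
open import Relation.Nullary using (¬_; Dec; yes; no; does; ¬?; contradiction; decidable-stable)
open import Relation.Nullary.Decidable using (_×-dec_; _→-dec_; dec-true)
open import Relation.Unary using (Decidable)
open import Relation.Binary.PropositionalEquality
  using (_≡_; _≢_; _≗_; refl; sym; trans; cong; subst)

-- Finite subsets: extensionality, cardinalities, comprehension and transversals.

private
  variable
    n : ℕ

lookup-injective : {p q : Subset n} → lookup p ≗ lookup q → p ≡ q
lookup-injective {p = p} {q} eq =
  trans (sym (tabulate∘lookup p)) (trans (tabulate-cong eq) (tabulate∘lookup q))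

∉⇒lookup : {x : Fin n} {p : Subset n} → x ∉ p → lookup p x ≡ false
∉⇒lookup {x = x} {p} x∉p = ¬-not (x∉p ∘ lookup⇒[]= x p)

∉-∪ : {x : Fin n} {p q : Subset n} → x ∉ p → x ∉ q → x ∉ p ∪ q
∉-∪ {p = p} {q} x∉p x∉q = [ x∉p , x∉q ]′ ∘ x∈p∪q⁻ p q

∣p∪q∣≡∣p∣+∣q∣ : (p q : Subset n) → (∀ {x} → x ∈ p → x ∉ q) → ∣ p ∪ q ∣ ≡ ∣ p ∣ + ∣ q ∣
∣p∪q∣≡∣p∣+∣q∣ []          []          disj = refl
∣p∪q∣≡∣p∣+∣q∣ (true ∷ p)  (true ∷ q)  disj = contradiction here (disj here)
∣p∪q∣≡∣p∣+∣q∣ (true ∷ p)  (false ∷ q) disj =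
  cong suc (∣p∪q∣≡∣p∣+∣q∣ p q λ x∈p → disj (there x∈p) ∘ there)
∣p∪q∣≡∣p∣+∣q∣ (false ∷ p) (true ∷ q)  disj =
  trans (cong suc (∣p∪q∣≡∣p∣+∣q∣ p q λ x∈p → disj (there x∈p) ∘ there)) (sym (+-suc ∣ p ∣ ∣ q ∣))
∣p∪q∣≡∣p∣+∣q∣ (false ∷ p) (false ∷ q) disj = ∣p∪q∣≡∣p∣+∣q∣ p q λ x∈p → disj (there x∈p) ∘ there

∣p∪⁅x⁆∣≡1+∣p∣ : {x : Fin n} (p : Subset n) → x ∉ p → ∣ p ∪ ⁅ x ⁆ ∣ ≡ suc ∣ p ∣
∣p∪⁅x⁆∣≡1+∣p∣ {x = x} p x∉p = trans
  (∣p∪q∣≡∣p∣+∣q∣ p ⁅ x ⁆ λ y∈p y∈x → x∉p (subst (_∈ p) (x∈⁅y⁆⇒x≡y x y∈x) y∈p))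
  (trans (cong (∣ p ∣ +_) (∣⁅x⁆∣≡1 x)) (+-comm ∣ p ∣ 1))

∣∁p∣+∣p∣≡n : (p : Subset n) → ∣ ∁ p ∣ + ∣ p ∣ ≡ n
∣∁p∣+∣p∣≡n p = trans (cong (_+ ∣ p ∣) (∣∁p∣≡n∸∣p∣ p)) (m∸n+n≡m (∣p∣≤n p))

module _ {P : Fin n → Set} (P? : Decidable P) where

  comprehension : Subset n
  comprehension = tabulateᵛ (does ∘ P?)

  ∈-comprehension⁺ : ∀ {x} → P x → x ∈ comprehension
  ∈-comprehension⁺ {x} px =
    lookup⇒[]= x comprehension (trans (lookup∘tabulate (does ∘ P?) x) (dec-true (P? x) px))

  ∈-comprehension⁻ : ∀ {x} → x ∈ comprehension → P x
  ∈-comprehension⁻ {x} x∈ with P? x | trans (sym (lookup∘tabulate (does ∘ P?) x)) ([]=⇒lookup x∈)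
  ... | yes px | _ = px

-- Chooses one preimage for each listed value. The clause `f v ∈ˡ ys` is carried through the
-- induction because it shows that the next chosen vertex is new: its value does not occur in the
-- tail.
transversal : {A : Set} {P : Fin n → Set} (f : Fin n → A) (ys : List A) → Unique ys →
  All (λ y → ∃ λ v → P v × y ≡ f v) ys →
  Σ (Subset n) λ R → ∣ R ∣ ≡ length ys × (∀ {v} → v ∈ R → P v × f v ∈ˡ ys)
    × (∀ {u v} → u ∈ R → v ∈ R → f u ≡ f v → u ≡ v)
transversal {n} f [] [] [] =
  ∅ , ∣⊥∣≡0 n , (λ v∈∅ → ⊥-elim (∉⊥ v∈∅)) , (λ u∈∅ → ⊥-elim (∉⊥ u∈∅))
transversal {n} {P = P} f (y ∷ ys) (y∉ys ∷ uniq) ((v , Pv , y≡fv) ∷ images)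
  with transversal f ys uniq images
... | R , size , sound , inj =
  R ∪ ⁅ v ⁆ , trans (∣p∪⁅x⁆∣≡1+∣p∣ R v∉R) (cong suc size) , sound′ , inj′
  where
  fresh : ∀ {u} → u ∈ R → f u ≢ f v
  fresh u∈R fu≡fv = All.lookup y∉ys (proj₂ (sound u∈R)) (trans y≡fv (sym fu≡fv))

  v∉R : v ∉ R
  v∉R v∈R = fresh v∈R refl

  sound′ : ∀ {u} → u ∈ R ∪ ⁅ v ⁆ → P u × f u ∈ˡ (y ∷ ys)
  sound′ u∈ with x∈p∪q⁻ R ⁅ v ⁆ u∈
  ... | inj₁ u∈R = proj₁ (sound u∈R) , there (proj₂ (sound u∈R))
  ... | inj₂ u∈v with refl ← x∈⁅y⁆⇒x≡y v u∈v = Pv , here (sym y≡fv)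

  inj′ : ∀ {a b} → a ∈ R ∪ ⁅ v ⁆ → b ∈ R ∪ ⁅ v ⁆ → f a ≡ f b → a ≡ b
  inj′ a∈ b∈ eq with x∈p∪q⁻ R ⁅ v ⁆ a∈ | x∈p∪q⁻ R ⁅ v ⁆ b∈
  ... | inj₁ a∈R | inj₁ b∈R = inj a∈R b∈R eq
  ... | inj₁ a∈R | inj₂ b∈v with refl ← x∈⁅y⁆⇒x≡y v b∈v = contradiction eq (fresh a∈R)
  ... | inj₂ a∈v | inj₁ b∈R with refl ← x∈⁅y⁆⇒x≡y v a∈v = contradiction (sym eq) (fresh b∈R)
  ... | inj₂ a∈v | inj₂ b∈v = trans (x∈⁅y⁆⇒x≡y v a∈v) (sym (x∈⁅y⁆⇒x≡y v b∈v))

-- Traces and twins.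

module _ (G : Digraph n) where
  open Digraph G

  -- Equality of the traces on `D` in pointwise form, so that passing to a smaller set is mere
  -- restriction.
  Agree : Subset n → Fin n → Fin n → Set
  Agree D u v = ∀ w → w ∈ D → Arc w u ≡ Arc w v

  agree? : ∀ D u v → Dec (Agree D u v)
  agree? D u v = all? λ w → (w ∈? D) →-dec (Arc w u ≟ᵇ Arc w v)

  agree-⊆ : ∀ {D E u v} → D ⊆ E → Agree E u v → Agree D u v
  agree-⊆ D⊆E h w w∈D = h w (D⊆E w∈D)

  agree-sym : ∀ {D u v} → Agree D u v → Agree D v u
  agree-sym h w w∈D = sym (h w w∈D)

  agree-trans : ∀ {D u v x} → Agree D u v → Agree D v x → Agree D u x
  agree-trans h k w w∈D = trans (h w w∈D) (k w w∈D)

  lookup-N⁻ : ∀ u w → lookup (N⁻ G u) w ≡ Arc w u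
  lookup-N⁻ u = lookup∘tabulate (λ w → Arc w u)

  lookup-trace : ∀ D u w → lookup (N⁻ G u ∩ D) w ≡ Arc w u ∧ lookup D w
  lookup-trace D u w = trans (lookup-zipWith _∧_ w (N⁻ G u) D) (cong (_∧ lookup D w) (lookup-N⁻ u w))

  trace-≡⇒agree : ∀ {D u v} → N⁻ G u ∩ D ≡ N⁻ G v ∩ D → Agree D u v
  trace-≡⇒agree {D} {u} {v} eq w w∈D =
    trans (sym (at u)) (trans (cong (λ p → lookup p w) eq) (at v))
    where
    at : ∀ u → lookup (N⁻ G u ∩ D) w ≡ Arc w u
    at u = trans (lookup-trace D u w) (trans (cong (Arc w u ∧_) ([]=⇒lookup w∈D)) (∧-identityʳ _))

  agree⇒trace-≡ : ∀ {D u v} → Agree D u v → N⁻ G u ∩ D ≡ N⁻ G v ∩ D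
  agree⇒trace-≡ {D} {u} {v} h = lookup-injective λ w →
    trans (lookup-trace D u w) (trans (at w) (sym (lookup-trace D v w)))
    where
    at : ∀ w → Arc w u ∧ lookup D w ≡ Arc w v ∧ lookup D w
    at w with w ∈? D
    ... | yes w∈D = cong (_∧ lookup D w) (h w w∈D)
    ... | no  w∉D rewrite ∉⇒lookup w∉D = trans (∧-zeroʳ (Arc w u)) (sym (∧-zeroʳ (Arc w v)))

  lookup-N⁻[] : ∀ u w → lookup (N⁻[_] G u) w ≡ Arc w u ∨ lookup ⁅ u ⁆ w
  lookup-N⁻[] u w =
    trans (lookup-zipWith _∨_ w (N⁻ G u) ⁅ u ⁆) (cong (_∨ lookup ⁅ u ⁆ w) (lookup-N⁻ u w))

  lookup-N⁻[]-self : ∀ u → lookup (N⁻[_] G u) u ≡ true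
  lookup-N⁻[]-self u =
    trans (lookup-N⁻[] u u) (trans (cong (Arc u u ∨_) ([]=⇒lookup (x∈⁅x⁆ u))) (∨-zeroʳ _))

  lookup-N⁻[]-other : ∀ {u w} → w ≢ u → lookup (N⁻[_] G u) w ≡ Arc w u
  lookup-N⁻[]-other {u} {w} w≢u = trans (lookup-N⁻[] u w)
    (trans (cong (Arc w u ∨_) (∉⇒lookup (x≢y⇒x∉⁅y⁆ w≢u))) (∨-identityʳ _))

  -- For such a pair, only the two possible arcs between `u` and `v` remain to be known. The next
  -- three lemmas treat no arc, both arcs and one arc.
  SimilarElsewhere : Fin n → Fin n → Set
  SimilarElsewhere u v = ∀ w → w ≢ u → w ≢ v → Arc w u ≡ Arc w v

  similar∧no-arcs⇒N⁻-≡ : ∀ {u v} → SimilarElsewhere u v →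
    Arc u v ≡ false → Arc v u ≡ false → N⁻ G u ≡ N⁻ G v
  similar∧no-arcs⇒N⁻-≡ {u} {v} sim uv vu = tabulate-cong go
    where
    go : ∀ w → Arc w u ≡ Arc w v
    go w with w ≟ u | w ≟ v
    ... | yes refl | _        = trans (loopless w) (sym uv)
    ... | no _     | yes refl = trans vu (sym (loopless w))
    ... | no w≢u   | no w≢v   = sim w w≢u w≢v

  similar∧both-arcs⇒N⁻[]-≡ : ∀ {u v} → u ≢ v → SimilarElsewhere u v →
    Arc u v ≡ true → Arc v u ≡ true → N⁻[_] G u ≡ N⁻[_] G v
  similar∧both-arcs⇒N⁻[]-≡ {u} {v} u≢v sim uv vu = lookup-injective go
    where
    go : ∀ w → lookup (N⁻[_] G u) w ≡ lookup (N⁻[_] G v) w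
    go w with w ≟ u | w ≟ v
    ... | yes refl | _        = trans (lookup-N⁻[]-self w) (sym (trans (lookup-N⁻[]-other u≢v) uv))
    ... | no w≢u   | yes refl = trans (trans (lookup-N⁻[]-other w≢u) vu) (sym (lookup-N⁻[]-self w))
    ... | no w≢u   | no w≢v   =
      trans (lookup-N⁻[]-other w≢u) (trans (sim w w≢u w≢v) (sym (lookup-N⁻[]-other w≢v)))

  -- The source `u` lies in both sets, by the arc and by closure; `v` lies in neither, by
  -- looplessness and by the absent arc.
  similar∧one-arc⇒quasiTwins : ∀ {u v} → SimilarElsewhere u v →
    Arc u v ≡ true → Arc v u ≡ false → QuasiTwins G v u
  similar∧one-arc⇒quasiTwins {u} {v} sim uv vu =
    lookup-injective λ w → trans (lookup-N⁻ v w) (go w)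
    where
    go : ∀ w → Arc w v ≡ lookup (N⁻[_] G u) w
    go w with w ≟ u | w ≟ v
    ... | yes refl | _        = trans uv (sym (lookup-N⁻[]-self w))
    ... | no w≢u   | yes refl = trans (trans (loopless w) (sym vu)) (sym (lookup-N⁻[]-other w≢u))
    ... | no w≢u   | no w≢v   = trans (sym (sim w w≢u w≢v)) (sym (lookup-N⁻[]-other w≢u))

  -- Configurations and their complements.

  Locating : Subset n → Set
  Locating D = ∀ {u v} → u ∉ D → v ∉ D → Agree D u v → u ≡ v

  locatingDominating : ∀ {D} → Dominating G D → Locating D → LocatingDominating G D
  locatingDominating dom loc = dom , λ u v u∉D v∉D u≢v eq → u≢v (loc u∉D v∉D (trace-≡⇒agree eq))

  record Configuration (S R : Subset n) : Set where
    field
      dominating : Dominating G S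
      disjoint   : ∀ {v} → v ∈ S → v ∉ R
      distinct   : ∀ {u v} → u ∈ R → v ∈ R → Agree S u v → u ≡ v

  open Configuration

  -- The initial configuration: `R` takes one vertex from each part of the `S`-partition.
  partition-configuration : ∀ S → Dominating G S →
    Σ (Subset n) λ R → Configuration S R × ∣ R ∣ ≡ partitionSize G S
  partition-configuration S dom
    with R , size , sound , inj ← transversal {P = _∉ S} (λ v → N⁻ G v ∩ S) _
           (deduplicate-! (≡-dec _≟ᵇ_) (map (λ v → N⁻ G v ∩ S) (filter (λ v → ¬? (v ∈? S)) (allFin n))))
           (tabulate λ y∈ →
             let v , v∈ , y≡ = ∈-map⁻ _ (∈-deduplicate⁻ (≡-dec _≟ᵇ_) _ y∈)
             in v , proj₂ (∈-filter⁻ (λ v → ¬? (v ∈? S)) {xs = allFin n} v∈) , y≡) =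
    R , record
      { dominating = dom
      ; disjoint   = λ v∈S v∈R → proj₁ (sound v∈R) v∈S
      ; distinct   = λ u∈R v∈R h → inj u∈R v∈R (agree⇒trace-≡ h)
      } , size

  dominating-⊆ : ∀ {D E} → D ⊆ E → Dominating G D → Dominating G E
  dominating-⊆ D⊆E dom v v∉E =
    let u , u∈D , uv = dom v (v∉E ∘ D⊆E) in u , D⊆E u∈D , uv

  -- By disjointness `S` lies in the complement of `R`, and traces on `S` already tell the vertices
  -- of `R` apart.
  ∁-locatingDominating : ∀ {S R} → Configuration S R → LocatingDominating G (∁ R)
  ∁-locatingDominating {S} {R} c = locatingDominating (dominating-⊆ S⊆∁R (dominating c))
    λ u∉ v∉ h → distinct c (x∉∁p⇒x∈p u∉) (x∉∁p⇒x∈p v∉) (agree-⊆ S⊆∁R h)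
    where
    S⊆∁R : S ⊆ ∁ R
    S⊆∁R v∈S = x∉p⇒x∈∁p (disjoint c v∈S)

  -- Enlarging `S` keeps old representatives distinct, so only `x` has to be compared with `R`.
  extend : ∀ {S R w x} → Configuration S R → w ∉ R → x ∉ S → x ≢ w →
    (∀ {r} → r ∈ R → ¬ Agree (S ∪ ⁅ w ⁆) r x) → Configuration (S ∪ ⁅ w ⁆) (R ∪ ⁅ x ⁆)
  extend {S} {R} {w} {x} c w∉R x∉S x≢w fresh = record
    { dominating = dominating-⊆ S⊆ (dominating c)
    ; disjoint   = disj
    ; distinct   = dist
    }
    where
    S⊆ : S ⊆ S ∪ ⁅ w ⁆
    S⊆ = p⊆p∪q ⁅ w ⁆

    disj : ∀ {v} → v ∈ S ∪ ⁅ w ⁆ → v ∉ R ∪ ⁅ x ⁆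
    disj v∈ with x∈p∪q⁻ S ⁅ w ⁆ v∈
    ... | inj₁ v∈S = ∉-∪ (disjoint c v∈S) λ v∈x → x∉S (subst (_∈ S) (x∈⁅y⁆⇒x≡y x v∈x) v∈S)
    ... | inj₂ v∈w with refl ← x∈⁅y⁆⇒x≡y w v∈w = ∉-∪ w∉R (x≢y⇒x∉⁅y⁆ (x≢w ∘ sym))

    dist : ∀ {a b} → a ∈ R ∪ ⁅ x ⁆ → b ∈ R ∪ ⁅ x ⁆ → Agree (S ∪ ⁅ w ⁆) a b → a ≡ b
    dist a∈ b∈ h with x∈p∪q⁻ R ⁅ x ⁆ a∈ | x∈p∪q⁻ R ⁅ x ⁆ b∈
    ... | inj₁ a∈R | inj₁ b∈R = distinct c a∈R b∈R (agree-⊆ S⊆ h)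
    ... | inj₁ a∈R | inj₂ b∈x with refl ← x∈⁅y⁆⇒x≡y x b∈x = contradiction h (fresh a∈R)
    ... | inj₂ a∈x | inj₁ b∈R with refl ← x∈⁅y⁆⇒x≡y x a∈x = contradiction (agree-sym h) (fresh b∈R)
    ... | inj₂ a∈x | inj₂ b∈x = trans (x∈⁅y⁆⇒x≡y x a∈x) (sym (x∈⁅y⁆⇒x≡y x b∈x))

  -- Growing a configuration until it is saturated.

  Indistinct : Subset n → Fin n → Fin n → Set
  Indistinct T u v = u ∉ T × v ∉ T × Agree T u v

  indistinct? : ∀ T u v → Dec (Indistinct T u v)
  indistinct? T u v = ¬? (u ∈? T) ×-dec ¬? (v ∈? T) ×-dec agree? T u v

  Separator : Subset n → Fin n → Fin n → Fin n → Set
  Separator T u v w = Indistinct T u v × w ≢ u × w ≢ v × Arc w u ≢ Arc w v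

  Saturated : Subset n → Set
  Saturated T = ∀ {u v} → Indistinct T u v → SimilarElsewhere u v

  separator? : ∀ T → Dec (∃ λ u → ∃ λ v → ∃ λ w → Separator T u v w)
  separator? T = any? λ u → any? λ v → any? λ w →
    indistinct? T u v ×-dec ¬? (w ≟ u) ×-dec ¬? (w ≟ v) ×-dec ¬? (Arc w u ≟ᵇ Arc w v)

  no-separator⇒saturated : ∀ {T} → ¬ (∃ λ u → ∃ λ v → ∃ λ w → Separator T u v w) → Saturated T
  no-separator⇒saturated none {u} {v} ind w w≢u w≢v =
    decidable-stable (Arc w u ≟ᵇ Arc w v) λ ne → none (u , v , w , ind , w≢u , w≢v , ne)

  -- The representative in R of the common part of u and v, if there is one, is
  -- separated by w from u or from v; the latter vertex is then a new representative.
  grow : ∀ {S R u v w} → Configuration S R → Separator (S ∪ R) u v w →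
    w ∉ S × ∃ λ x → x ∉ R × Configuration (S ∪ ⁅ w ⁆) (R ∪ ⁅ x ⁆)
  grow {S} {R} {u} {v} {w} c ((u∉T , v∉T , h) , w≢u , w≢v , ne) = w∉T ∘ S⊆T , new
    where
    S⊆T : S ⊆ S ∪ R
    S⊆T = p⊆p∪q R

    R⊆T : R ⊆ S ∪ R
    R⊆T = q⊆p∪q S R

    w∉T : w ∉ S ∪ R
    w∉T w∈T = ne (h w w∈T)

    S⊆S′ : S ⊆ S ∪ ⁅ w ⁆
    S⊆S′ = p⊆p∪q ⁅ w ⁆

    w∈S′ : w ∈ S ∪ ⁅ w ⁆
    w∈S′ = q⊆p∪q S ⁅ w ⁆ (x∈⁅x⁆ w)

    new : ∃ λ x → x ∉ R × Configuration (S ∪ ⁅ w ⁆) (R ∪ ⁅ x ⁆)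
    new with any? (λ r → (r ∈? R) ×-dec agree? (S ∪ ⁅ w ⁆) r u)
    ... | no none = u , u∉T ∘ R⊆T ,
      extend c (w∉T ∘ R⊆T) (u∉T ∘ S⊆T) (w≢u ∘ sym) λ {r} r∈R k → none (r , r∈R , k)
    ... | yes (r , r∈R , r~u) = v , v∉T ∘ R⊆T ,
      extend c (w∉T ∘ R⊆T) (v∉T ∘ S⊆T) (w≢v ∘ sym) λ {r′} r′∈R r′~v →
        case distinct c r∈R r′∈R
               (agree-trans (agree-⊆ S⊆S′ r~u)
                 (agree-trans (agree-⊆ S⊆T h) (agree-sym (agree-⊆ S⊆S′ r′~v)))) of λ where
          refl → ne (trans (sym (r~u w w∈S′)) (r′~v w w∈S′))

  -- The fuel `k` bounds the number of vertices outside `S`, and each round moves one of them into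
  -- `S`. The ratio survives because `S` and `R` both gain one element, which adds `p` on the left
  -- and `q` on the right.
  saturate : ∀ {p q} → p ≤ q → ∀ k {S R} → n ≤ k + ∣ S ∣ →
    Configuration S R → p * ∣ S ∣ ≤ q * ∣ R ∣ →
    Σ (Subset n) λ S′ → Σ (Subset n) λ R′ →
      Configuration S′ R′ × Saturated (S′ ∪ R′) × p * ∣ S′ ∣ ≤ q * ∣ R′ ∣
  saturate {p} {q} p≤q k {S} {R} n≤ c ratio with separator? (S ∪ R)
  ... | no none = S , R , c , no-separator⇒saturated none , ratio
  ... | yes (u , v , w , sep) with grow c sep
  ... | w∉S , x , x∉R , c′ = continue k n≤
    where
    open ≤-Reasoning

    ∣S′∣ : ∣ S ∪ ⁅ w ⁆ ∣ ≡ suc ∣ S ∣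
    ∣S′∣ = ∣p∪⁅x⁆∣≡1+∣p∣ S w∉S

    ratio′ : p * ∣ S ∪ ⁅ w ⁆ ∣ ≤ q * ∣ R ∪ ⁅ x ⁆ ∣
    ratio′ = begin
      p * ∣ S ∪ ⁅ w ⁆ ∣  ≡⟨ cong (p *_) ∣S′∣ ⟩
      p * suc ∣ S ∣      ≡⟨ *-suc p ∣ S ∣ ⟩
      p + p * ∣ S ∣      ≤⟨ +-mono-≤ p≤q ratio ⟩
      q + q * ∣ R ∣      ≡⟨ *-suc q ∣ R ∣ ⟨
      q * suc ∣ R ∣      ≡⟨ cong (q *_) (∣p∪⁅x⁆∣≡1+∣p∣ R x∉R) ⟨
      q * ∣ R ∪ ⁅ x ⁆ ∣  ∎

    continue : ∀ k → n ≤ k + ∣ S ∣ → Σ (Subset n) λ S′ → Σ (Subset n) λ R′ →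
      Configuration S′ R′ × Saturated (S′ ∪ R′) × p * ∣ S′ ∣ ≤ q * ∣ R′ ∣
    -- Without fuel `S` already has `n` elements, which leaves no room for `w`.
    continue zero n≤∣S∣ =
      contradiction (≤-trans (subst (_≤ n) ∣S′∣ (∣p∣≤n (S ∪ ⁅ w ⁆))) n≤∣S∣) 1+n≰n
    continue (suc k) n≤ = saturate p≤q k
      (≤-trans n≤ (≤-reflexive (trans (sym (+-suc k ∣ S ∣)) (cong (k +_) (sym ∣S′∣))))) c′ ratio′

  -- Matched pairs in a saturated configuration.

  module _ (twinFree : TwinFree G) {S R : Subset n} (c : Configuration S R)
           (sat : Saturated (S ∪ R)) where

    T : Subset n
    T = S ∪ R

    -- By saturation and twin-freeness these are quasi-twins with `N⁻(v) = N⁻(u) ∪ {u}`.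
    Matched : Fin n → Fin n → Set
    Matched u v = Indistinct T u v × Arc u v ≡ true

    matched? : ∀ u v → Dec (Matched u v)
    matched? u v = indistinct? T u v ×-dec (Arc u v ≟ᵇ true)

    matched⇒≢ : ∀ {u v} → Matched u v → u ≢ v
    matched⇒≢ {u} (_ , uv) refl = case trans (sym uv) (loopless u) of λ ()

    -- Arcs in both directions would make the closed in-neighbourhoods equal.
    matched⇒¬reverse : ∀ {u v} → Matched u v → Arc v u ≢ true
    matched⇒¬reverse {u} {v} m@(ind , uv) vu =
      twinFree u v (u≢v , inj₂ (similar∧both-arcs⇒N⁻[]-≡ u≢v (sat ind) uv vu))
      where u≢v = matched⇒≢ m

    -- With no arc between them, the two vertices would have equal open in-neighbourhoods.
    indistinct⇒matched : ∀ {u v} → u ≢ v → Indistinct T u v → Matched u v ⊎ Matched v u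
    indistinct⇒matched {u} {v} u≢v ind@(u∉T , v∉T , h) with Arc u v in uv | Arc v u in vu
    ... | true  | _     = inj₁ (ind , refl)
    ... | false | true  = inj₂ ((v∉T , u∉T , agree-sym h) , refl)
    ... | false | false =
      ⊥-elim (twinFree u v (u≢v , inj₁ (similar∧no-arcs⇒N⁻-≡ (sat ind) uv vu)))

    -- Here `u` and `v` have the same trace on `T`, so saturation, applied to the third vertex `x`,
    -- turns the arc from `x` to `v` into an arc from `x` to `u`, the forbidden reverse arc. If `u`
    -- and `v` coincide, it is that arc already.
    matched-¬path : ∀ {u x v} → Matched u x → ¬ Matched x v
    matched-¬path {u} {x} {v} ux@((u∉T , _ , u~x) , u→x) xv@((_ , v∉T , x~v) , x→v)
      with u ≟ v
    ... | yes refl = matched⇒¬reverse ux x→v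
    ... | no u≢v   = matched⇒¬reverse ux
      (trans (sat (u∉T , v∉T , agree-trans u~x x~v) x (matched⇒≢ ux ∘ sym) (matched⇒≢ xv)) x→v)

    source? : Decidable λ u → ∃ λ v → Matched u v
    source? u = any? λ v → matched? u v

    target? : Decidable λ v → ∃ λ u → Matched u v
    target? v = any? λ u → matched? u v

    sources targets : Subset n
    sources = comprehension source?
    targets = comprehension target?

    -- A pair that `D` fails to separate is not separated by `T` either, hence is matched in one
    -- direction; it then suffices that `D` meets every matched pair.
    ⊇T-locatingDominating : ∀ {D} → T ⊆ D →
      (∀ {u v} → u ∉ D → v ∉ D → ¬ Matched u v) → LocatingDominating G D
    ⊇T-locatingDominating {D} T⊆D none =
      locatingDominating (dominating-⊆ (T⊆D ∘ p⊆p∪q R) (dominating c)) loc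
      where
      loc : Locating D
      loc {u} {v} u∉D v∉D h with u ≟ v
      ... | yes u≡v = u≡v
      ... | no  u≢v with indistinct⇒matched u≢v (u∉D ∘ T⊆D , v∉D ∘ T⊆D , agree-⊆ T⊆D h)
      ...   | inj₁ m = contradiction m (none u∉D v∉D)
      ...   | inj₂ m = contradiction m (none v∉D u∉D)

    ∣T∣ : ∣ T ∣ ≡ ∣ S ∣ + ∣ R ∣
    ∣T∣ = ∣p∪q∣≡∣p∣+∣q∣ S R (disjoint c)

    T-locatingDominating : QuasiTwinFree G → LocatingDominating G T
    T-locatingDominating quasiTwinFree = ⊇T-locatingDominating (λ x∈T → x∈T) λ {u} {v} _ _ m →
      quasiTwinFree v u
        (similar∧one-arc⇒quasiTwins (sat (proj₁ m)) (proj₂ m) (¬-not (matched⇒¬reverse m)))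

    T∩sources : ∀ {x} → x ∈ T → x ∉ sources
    T∩sources x∈T x∈ = let _ , (x∉T , _) , _ = ∈-comprehension⁻ source? x∈ in x∉T x∈T

    T∩targets : ∀ {x} → x ∈ T → x ∉ targets
    T∩targets x∈T x∈ = let _ , (_ , x∉T , _) , _ = ∈-comprehension⁻ target? x∈ in x∉T x∈T

    sources∩targets : ∀ {x} → x ∈ sources → x ∉ targets
    sources∩targets x∈s x∈t =
      matched-¬path (proj₂ (∈-comprehension⁻ target? x∈t)) (proj₂ (∈-comprehension⁻ source? x∈s))

    ∣T∣+∣sources∣+∣targets∣≤n : ∣ T ∣ + (∣ sources ∣ + ∣ targets ∣) ≤ n
    ∣T∣+∣sources∣+∣targets∣≤n = begin
      ∣ T ∣ + (∣ sources ∣ + ∣ targets ∣)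
        ≡⟨ cong (∣ T ∣ +_) (∣p∪q∣≡∣p∣+∣q∣ sources targets sources∩targets) ⟨
      ∣ T ∣ + ∣ sources ∪ targets ∣
        ≡⟨ ∣p∪q∣≡∣p∣+∣q∣ T _ (λ x∈T → ∉-∪ (T∩sources x∈T) (T∩targets x∈T)) ⟨
      ∣ T ∪ (sources ∪ targets) ∣
        ≤⟨ ∣p∣≤n (T ∪ (sources ∪ targets)) ⟩
      n ∎
      where open ≤-Reasoning

    -- To be used with `X` the smaller of `sources` and `targets` and `m` the size of the other: `X`
    -- fills at most half of the space outside `T`.
    half-size : ∀ (X : Subset n) {m} → (∀ {x} → x ∈ T → x ∉ X) → ∣ X ∣ ≤ m →
      ∣ T ∣ + (∣ X ∣ + m) ≤ n → 2 * ∣ T ∪ X ∣ ≤ n + (∣ S ∣ + ∣ R ∣)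
    half-size X {m} T∩X X≤m total = begin
      2 * ∣ T ∪ X ∣                    ≡⟨ cong (2 *_) (∣p∪q∣≡∣p∣+∣q∣ T X T∩X) ⟩
      2 * (∣ T ∣ + ∣ X ∣)              ≡⟨ rearrange ∣ T ∣ ∣ X ∣ ⟩
      ∣ T ∣ + (∣ X ∣ + ∣ X ∣) + ∣ T ∣  ≤⟨ +-monoˡ-≤ ∣ T ∣ (+-monoʳ-≤ ∣ T ∣ (+-monoʳ-≤ ∣ X ∣ X≤m)) ⟩
      ∣ T ∣ + (∣ X ∣ + m) + ∣ T ∣      ≤⟨ +-monoˡ-≤ ∣ T ∣ total ⟩
      n + ∣ T ∣                        ≡⟨ cong (n +_) ∣T∣ ⟩
      n + (∣ S ∣ + ∣ R ∣)              ∎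
      where
      open ≤-Reasoning
      rearrange : ∀ t x → 2 * (t + x) ≡ t + (x + x) + t
      rearrange = solve-∀

    -- Every matched pair consists of a source and a target, so either set meets all of them.
    half-locatingDominating :
      Σ (Subset n) λ D → LocatingDominating G D × 2 * ∣ D ∣ ≤ n + (∣ S ∣ + ∣ R ∣)
    half-locatingDominating with ≤-total ∣ sources ∣ ∣ targets ∣
    ... | inj₁ s≤t = T ∪ sources
        , ⊇T-locatingDominating (p⊆p∪q sources)
            (λ u∉ _ → u∉ ∘ q⊆p∪q T sources ∘ ∈-comprehension⁺ source? ∘ (_ ,_))
        , half-size sources T∩sources s≤t ∣T∣+∣sources∣+∣targets∣≤n
    ... | inj₂ t≤s = T ∪ targets
        , ⊇T-locatingDominating (p⊆p∪q targets)
            (λ _ v∉ → v∉ ∘ q⊆p∪q T targets ∘ ∈-comprehension⁺ target? ∘ (_ ,_))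
        , half-size targets T∩targets t≤s
            (≤-trans (≤-reflexive (cong (∣ T ∣ +_) (+-comm ∣ targets ∣ ∣ sources ∣)))
              ∣T∣+∣sources∣+∣targets∣≤n)

-- Arithmetic of the bounds.

complement-bound : ∀ a p {d r n} → d + r ≡ n → p * n ≤ (p + a) * r → (p + a) * d ≤ a * n
complement-bound a p {d} {r} refl pn≤ = +-cancelʳ-≤ (p * (d + r)) _ _ (begin
  (p + a) * d + p * (d + r)        ≤⟨ +-monoʳ-≤ ((p + a) * d) pn≤ ⟩
  (p + a) * d + (p + a) * r        ≡⟨ rearrange p a d r ⟩
  a * (d + r) + p * (d + r)        ∎)
  where
  open ≤-Reasoning
  rearrange : ∀ p a d r → (p + a) * d + (p + a) * r ≡ a * (d + r) + p * (d + r)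
  rearrange = solve-∀

-- From `s ≤ (q/p) r` and `r ≤ p n / (3p + q)` follows `s + r ≤ (p + q) n / (3p + q)`, which is put
-- into the bound on `2 * d`. Multiplying through by `2 * p` keeps the computation in the naturals.
half-bound : ∀ {p q d n s r} → 0 < p → p * s ≤ q * r → 2 * d ≤ n + (s + r) →
  (3 * p + q) * r ≤ p * n → (3 * p + q) * d ≤ (2 * p + q) * n
half-bound {p} {q} {d} {n} {s} {r} 0<p ps≤qr 2d≤ ≤pn = *-cancelˡ-≤ p (*-cancelˡ-≤ 2 (begin
  2 * (p * ((3 * p + q) * d))                         ≡⟨ e₁ p q d ⟩
  p * (3 * p + q) * (2 * d)                           ≤⟨ *-monoʳ-≤ (p * (3 * p + q)) 2d≤ ⟩
  p * (3 * p + q) * (n + (s + r))                     ≡⟨ e₂ p q n s r ⟩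
  (3 * p + q) * (p * n + (p * s + p * r))
    ≤⟨ *-monoʳ-≤ (3 * p + q) (+-monoʳ-≤ (p * n) (+-monoˡ-≤ (p * r) ps≤qr)) ⟩
  (3 * p + q) * (p * n + (q * r + p * r))             ≡⟨ e₃ p q n r ⟩
  p * (3 * p + q) * n + (p + q) * ((3 * p + q) * r)   ≤⟨ +-monoʳ-≤ _ (*-monoʳ-≤ (p + q) ≤pn) ⟩
  p * (3 * p + q) * n + (p + q) * (p * n)             ≡⟨ e₄ p q n ⟩
  2 * (p * ((2 * p + q) * n))                         ∎))
  where
  open ≤-Reasoning
  instance
    p≢0 : NonZero p
    p≢0 = >-nonZero 0<p
  e₁ : ∀ p q d → 2 * (p * ((3 * p + q) * d)) ≡ p * (3 * p + q) * (2 * d)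
  e₁ = solve-∀
  e₂ : ∀ p q n s r → p * (3 * p + q) * (n + (s + r)) ≡ (3 * p + q) * (p * n + (p * s + p * r))
  e₂ = solve-∀
  e₃ : ∀ p q n r → (3 * p + q) * (p * n + (q * r + p * r)) ≡
    p * (3 * p + q) * n + (p + q) * ((3 * p + q) * r)
  e₃ = solve-∀
  e₄ : ∀ p q n → p * (3 * p + q) * n + (p + q) * (p * n) ≡ 2 * (p * ((2 * p + q) * n))
  e₄ = solve-∀

-- The same substitution with the threshold `r ≤ p n / (2p + q)`, now applied directly to `s + r`.
union-bound : ∀ {p q n s r} → 0 < p → p * s ≤ q * r →
  (2 * p + q) * r ≤ p * n → (2 * p + q) * (s + r) ≤ (p + q) * n
union-bound {p} {q} {n} {s} {r} 0<p ps≤qr ≤pn = *-cancelˡ-≤ p (begin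
  p * ((2 * p + q) * (s + r))        ≡⟨ e₁ p q s r ⟩
  (2 * p + q) * (p * s + p * r)      ≤⟨ *-monoʳ-≤ (2 * p + q) (+-monoˡ-≤ (p * r) ps≤qr) ⟩
  (2 * p + q) * (q * r + p * r)      ≡⟨ e₂ p q r ⟩
  (p + q) * ((2 * p + q) * r)        ≤⟨ *-monoʳ-≤ (p + q) ≤pn ⟩
  (p + q) * (p * n)                  ≡⟨ e₃ p q n ⟩
  p * ((p + q) * n)                  ∎)
  where
  open ≤-Reasoning
  instance
    p≢0 : NonZero p
    p≢0 = >-nonZero 0<p
  e₁ : ∀ p q s r → p * ((2 * p + q) * (s + r)) ≡ (2 * p + q) * (p * s + p * r)
  e₁ = solve-∀
  e₂ : ∀ p q r → (2 * p + q) * (q * r + p * r) ≡ (p + q) * ((2 * p + q) * r)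
  e₂ = solve-∀
  e₃ : ∀ p q n → (p + q) * (p * n) ≡ p * ((p + q) * n)
  e₃ = solve-∀

-- The number `x` is the fraction `p / q`, and all inequalities are stated with denominators
-- cleared.
theorem8 : ∀ {n : ℕ} (G : Digraph n) → TwinFree G →
    (S : Subset n) → Dominating G S →
    (p q : ℕ) → 0 < p → p ≤ q →
    p * ∣ S ∣ ≤ q * partitionSize G S →
    γL≤[ 2 * p + q / 3 * p + q ] G
    × (QuasiTwinFree G → γL≤[ p + q / 2 * p + q ] G)
theorem8 {n} G twinFree S₀ dom p q 0<p p≤q ratio₀
  with R₀ , c₀ , size ← partition-configuration G S₀ dom
  with S , R , c , sat , ratio ← saturate G p≤q n (m≤m+n n ∣ S₀ ∣) c₀
         (subst (λ r → p * ∣ S₀ ∣ ≤ q * r) (sym size) ratio₀) = general , quasiTwinFree-case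
  where
  ∁-bound : ∀ k → p * n ≤ (suc k * p + q) * ∣ R ∣ → (suc k * p + q) * ∣ ∁ R ∣ ≤ (k * p + q) * n
  ∁-bound k ≤r rewrite +-assoc p (k * p) q = complement-bound (k * p + q) p (∣∁p∣+∣p∣≡n R) ≤r

  general : γL≤[ 2 * p + q / 3 * p + q ] G
  -- At `|R| = p n / (3p + q)` the size `n − |R|` of the complement equals the target bound; below
  -- this threshold the half-size construction is good enough.
  general with ≤-total (p * n) ((3 * p + q) * ∣ R ∣)
  ... | inj₁ ≤r = ∁ R , ∁-locatingDominating G c , ∁-bound 2 ≤r
  ... | inj₂ r≤ with half-locatingDominating G twinFree c sat
  ...   | D , ld , 2d≤ = D , ld , half-bound {p} {q} 0<p ratio 2d≤ r≤

  quasiTwinFree-case : QuasiTwinFree G → γL≤[ p + q / 2 * p + q ] G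
  -- Likewise `n − |R|` meets the target at `|R| = p n / (2p + q)`, and for smaller `R` the set
  -- `S ∪ R` itself serves.
  quasiTwinFree-case quasiTwinFree with ≤-total (p * n) ((2 * p + q) * ∣ R ∣)
  ... | inj₁ ≤r = ∁ R , ∁-locatingDominating G c
      , subst (λ k → (2 * p + q) * ∣ ∁ R ∣ ≤ (k + q) * n) (*-identityˡ p) (∁-bound 1 ≤r)
  ... | inj₂ r≤ = S ∪ R , T-locatingDominating G twinFree c sat quasiTwinFree
      , subst (λ t → (2 * p + q) * t ≤ (p + q) * n) (sym (∣T∣ G twinFree c sat))
          (union-bound {p} {q} 0<p ratio r≤)
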